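{- Let $G$ be a connected undirected graph and let $L=\{L_1,L_2,\dots,L_k\}$ be a partition of $V(G)$ such that for every edge $xy\in E(G)$, either $x,y\in L_i$ for some $1\le i\le k$, or (up to exchanging $x$ and $y$) $x\in L_i$, $y\in L_{i+1}$ for some $1\le i\le k-1$. Let $(X,T)$, with $X=\{X_j \mid j\in V(T)\}$, be a tree decomposition of $G$, and let $$t^*=\max\{|L_i\cap X_j| : 1\le i\le k,\ j\in V(T)\}.$$ Then there are a graph $G_1$ with $CCW(G_1)\le 2t^*-1$ and a chordal graph $G_2$ such that $G=G_1\cap G_2$.
   Context: Graphs are finite, simple and undirected. For graphs $H_1,\dots,H_d$ all having the same vertex set $V$, $G=\bigcap_{i=1}^d H_i$ means that $V(G)=V$ and $E(G)=\bigcap_{i=1}^d E(H_i)$; thus in $G=G_1\cap G_2$ one has $V(G_1)=V(G_2)=V(G)$ and $E(G)=E(G_1)\cap E(G_2)$. A clique cover of a graph $G$ is a partition of $V(G)$ into cliques. For an ordered clique cover $C=\{C_0,C_1,\dots,C_t\}$, its width is $W(C)=\max\{|j-i| : xy\in E(G),\ x\in C_i,\ y\in C_j\}$. The clique cover width $CCW(G)$ is the smallest width over all ordered clique covers of $G$. A tree decomposition of $G$ is a pair $(X,T)$ where $T$ is a tree and $X=\{X_j\mid j\in V(T)\}$ is a family of subsets of $V(G)$ (called bags) such that: $\bigcup_{j\in V(T)}X_j=V(G)$; for every $uv\in E(G)$ there is $j\in V(T)$ with $u,v\in X_j$; and for all $i,j,k\in V(T)$, if $j$ is on the path from $i$ to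 $k$ in $T$, then $X_i\cap X_k\subseteq X_j$. A graph is chordal if it has no induced (chordless) cycle of length at least four. -}

module Defs where

open import Level using (0ℓ)
open import Data.Nat using (ℕ; suc; _≤_; ∣_-_∣)
open import Data.Fin using (Fin; toℕ)
open import Data.Fin.Properties using (any?)
open import Data.Fin.Subset using (Subset; _∈_; _∩_; _⊆_; ∣_∣; Nonempty)
open import Data.Fin.Subset.Properties using (_∈?_)
open import Data.List using (List; []; _∷_; map; filter; allFin; cartesianProduct)
open import Data.List.Extrema.Nat using (max)
import Data.List.Membership.Propositional as List
open import Data.List.Relation.Unary.Unique.Propositional using (Unique)
open import Data.Product using (∃; ∃-syntax; _×_; _,_)
open import Data.Sum using (_⊎_)
open import Function using (_⇔_; Injective)
open import Relation.Binary using (Rel; Symmetric; Irreflexive; Decidable)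
open import Relation.Binary.Construct.Closure.ReflexiveTransitive using (Star; ε; _◅_)
open import Relation.Binary.PropositionalEquality using (_≡_; _≢_)
open import Relation.Nullary using (¬_)
open import Relation.Nullary.Decidable using (_×-dec_)
import Relation.Unary as Unary

-- Adjacency is decidable, as it always is classically for a finite graph;
-- this makes the maximum in the definition of width computable.
record Graph (n : ℕ) : Set₁ where
  infix 4 _~_ _~?_
  field
    _~_    : Rel (Fin n) 0ℓ
    sym    : Symmetric _~_
    irrefl : Irreflexive _≡_ _~_
    _~?_   : Decidable _~_

open Graph using () renaming (_~_ to Adj)

infix 4 _≈ᴳ_

_≈ᴳ_ : ∀ {n} → Graph n → Graph n → Set
G ≈ᴳ H = ∀ x y → Adj G x y ⇔ Adj H x y

infixr 7 _∩ᴳ_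

_∩ᴳ_ : ∀ {n} → Graph n → Graph n → Graph n
G ∩ᴳ H = record
  { _~_    = λ x y → (x G.~ y) × (x H.~ y)
  ; sym    = λ (p , q) → G.sym p , H.sym q
  ; irrefl = λ x≡y (p , _) → G.irrefl x≡y p
  ; _~?_   = λ x y → (x G.~? y) ×-dec (x H.~? y)
  }
  where
  module G = Graph G
  module H = Graph H

Walk : ∀ {n} → Graph n → Fin n → Fin n → Set
Walk G = Star (Adj G)

vertices : ∀ {n} (G : Graph n) {x y : Fin n} → Walk G x y → List (Fin n)
vertices G {x} ε       = x ∷ []
vertices G {x} (_ ◅ w) = x ∷ vertices G w

IsPath : ∀ {n} (G : Graph n) {x y : Fin n} → Walk G x y → Set
IsPath G w = Unique (vertices G w)

-- The graph with no vertices does not count as connected.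
Connected : ∀ {n} → Graph n → Set
Connected {n} G = Fin n × (∀ x y → Walk G x y)

-- i ↝ j : j is the cyclic successor of i modulo ℓ.
infix 4 _↝_

_↝_ : ∀ {ℓ} → Fin ℓ → Fin ℓ → Set
_↝_ {ℓ} i j = (toℕ j ≡ suc (toℕ i)) ⊎ (suc (toℕ i) ≡ ℓ × toℕ j ≡ 0)

record Cycle {n} (G : Graph n) (ℓ : ℕ) : Set where
  field
    3≤ℓ       : 3 ≤ ℓ
    vertex    : Fin ℓ → Fin n
    injective : Injective _≡_ _≡_ vertex
    adjacent  : ∀ {i j} → i ↝ j → Adj G (vertex i) (vertex j)

Chordless : ∀ {n} {G : Graph n} {ℓ} → Cycle G ℓ → Set
Chordless {G = G} c = ∀ i j → Adj G (vertex i) (vertex j) → i ↝ j ⊎ j ↝ i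
  where open Cycle c

Chordal : ∀ {n} → Graph n → Set
Chordal G = ∀ {ℓ} → 4 ≤ ℓ → (c : Cycle G ℓ) → ¬ Chordless c

Acyclic : ∀ {n} → Graph n → Set
Acyclic G = ∀ {ℓ} → ¬ Cycle G ℓ

IsTree : ∀ {n} → Graph n → Set
IsTree T = Connected T × Acyclic T

record TreeDecomposition {n} (G : Graph n) : Set₁ where
  field
    {nodes}  : ℕ
    tree     : Graph nodes
    isTree   : IsTree tree
    bag      : Fin nodes → Subset n
    vertex-∈ : ∀ x → ∃[ j ] x ∈ bag j
    edge-∈   : ∀ {x y} → Adj G x y → ∃[ j ] (x ∈ bag j × y ∈ bag j)
    path-∩-⊆ : ∀ {i j k} (p : Walk tree i k) → IsPath tree p →
               j List.∈ vertices tree p → bag i ∩ bag k ⊆ bag j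

record IsPartition {n k} (P : Fin k → Subset n) : Set where
  field
    nonempty : ∀ i → Nonempty (P i)
    disjoint : ∀ {i j x} → x ∈ P i → x ∈ P j → i ≡ j
    covers   : ∀ x → ∃[ i ] x ∈ P i

Consecutive : ∀ {n k} → (Fin k → Subset n) → Fin n → Fin n → Set
Consecutive L x y = ∃[ i ] ∃[ j ] (toℕ j ≡ suc (toℕ i) × x ∈ L i × y ∈ L j)

record IsLayering {n k} (G : Graph n) (L : Fin k → Subset n) : Set where
  field
    isPartition : IsPartition L
    edges       : ∀ {x y} → Adj G x y →
                  (∃[ i ] (x ∈ L i × y ∈ L i)) ⊎
                  (Consecutive L x y ⊎ Consecutive L y x)

-- The default value 0 of max matters only if there are no layers or no bags.
maxLayerBag : ∀ {n k} {G : Graph n} → (Fin k → Subset n) → TreeDecomposition G → ℕ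
maxLayerBag {k = k} L D =
  max 0 (map (λ (i , j) → ∣ L i ∩ bag j ∣) (cartesianProduct (allFin k) (allFin nodes)))
  where open TreeDecomposition D

IsClique : ∀ {n} → Graph n → Subset n → Set
IsClique G S = ∀ {x y} → x ∈ S → y ∈ S → x ≢ y → Adj G x y

record OrderedCliqueCover {n} (G : Graph n) : Set where
  field
    {size}      : ℕ
    part        : Fin size → Subset n
    isPartition : IsPartition part
    isClique    : ∀ i → IsClique G (part i)

module _ {n} {G : Graph n} (C : OrderedCliqueCover G) where
  open Graph G
  open OrderedCliqueCover C

  Joined : Unary.Pred (Fin size × Fin size) 0ℓ
  Joined (i , j) = ∃[ x ] ∃[ y ] (x ~ y × x ∈ part i × y ∈ part j)

  joined? : Unary.Decidable Joined
  joined? (i , j) = any? λ x → any? λ y →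
    (x ~? y) ×-dec (x ∈? part i) ×-dec (y ∈? part j)

  -- An edgeless graph gets width 0.
  width : ℕ
  width = max 0 (map (λ (i , j) → ∣ toℕ j - toℕ i ∣)
                     (filter joined? (cartesianProduct (allFin size) (allFin size))))

-- IsCCW G w : the clique cover width of G exists and equals w.
IsCCW : ∀ {n} → Graph n → ℕ → Set
IsCCW G w = (∃ λ (C : OrderedCliqueCover G) → width C ≡ w) ×
            (∀ (C : OrderedCliqueCover G) → w ≤ width C)

{-# OPTIONS --safe #-}

-- Root the tree and let the home of a vertex x be the node closest to the root whose bag contains x.
-- If x and y share a bag and the home of x is at least as deep as that of y, then y lies in the bag
-- at the home of x. So ordering vertices by the depth of their homes is an elimination order of the
-- graph G₂ "x and y share a bag": G₂ is chordal, and since the neighbours of x in its own layer that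
-- precede x lie in a single bag, greedy colouring gives each layer t* colours such that vertices
-- sharing a layer and a bag get distinct colours. Let G₁ be G with every colour class of every layer
-- made a clique. The added edges join no two vertices sharing a bag, so G = G₁ ∩ G₂, and ordering the
-- classes by layer, then by colour, gives width at most 2t* − 1.

module Submission where

open import Defs
open import Data.Nat using (ℕ; _≤_; _*_; _∸_)
open import Data.Fin using (Fin)
open import Data.Fin.Subset using (Subset)
open import Data.Product using (∃-syntax; _×_)

open import Data.Bool.Base using (if_then_else_)
open import Data.Fin.Base
  using (zero; suc; toℕ; fromℕ; fromℕ<; inject₁; inject≤; punchOut; combine; finToFun; funToFin)
open import Data.Fin.Properties
  using (_≟_; any?; all?; 0≢1+n; suc-injective; toℕ<n; toℕ≤pred[n]; toℕ-injective; toℕ-fromℕ; toℕ-fromℕ<;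
         toℕ-inject₁; toℕ-inject≤; inject≤-injective; toℕ-combine; combine-injective; punchOut-injective;
         finToFun-funToFin; injective⇒≤)
open import Data.Fin.Subset using (_∈_; _∩_; ∣_∣) renaming (_-_ to _∖_)
open import Data.Fin.Subset.Properties
  using (_∈?_; x∈p∩q⁺; x∈p∧x≢y⇒x∈p-y; x∈p⇒∣p-x∣<∣p∣)
open import Data.List.Base using (List; []; _∷_; _++_; allFin; cartesianProduct)
open import Data.List.Extrema.Nat using (argmax; f[xs]≤f[argmax]; max≤v⁺; xs≤max)
open import Data.List.Membership.DecPropositional using () renaming (_∈?_ to member?)
import Data.List.Membership.Propositional as List
open import Data.List.Membership.Propositional.Properties
  using (∈-allFin; ∈-map⁺; ∈-filter⁺; ∈-filter⁻; ∈-cartesianProduct⁺; ∈-++⁺ˡ)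
open import Data.List.Relation.Binary.Permutation.Propositional using (↭-sym)
open import Data.List.Relation.Binary.Permutation.Propositional.Properties using (∈-resp-↭)
open import Data.List.Relation.Unary.All as All using (All; []; _∷_)
import Data.List.Relation.Unary.All.Properties as All
open import Data.List.Relation.Unary.AllPairs using (AllPairs; []; _∷_)
open import Data.List.Relation.Unary.Any using (here; there)
open import Data.List.Relation.Unary.Sorted.TotalOrder.Properties using (Sorted⇒AllPairs)
open import Data.List.Relation.Unary.Unique.Propositional using (Unique)
open import Data.List.Relation.Unary.Unique.Propositional.Properties using () renaming (++⁺ to unique-++⁺)
import Data.List.Sort as Sort
open import Data.Nat.Base using (zero; suc; _+_; _<_; _^_; z≤n; s≤s; ∣_-_∣)
open import Data.Nat.Induction using (<-wellFounded)
import Data.Nat.Properties as ℕ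
open import Data.Nat.Tactic.RingSolver using (solve-∀)
open import Data.Product.Base using (∃; _,_; proj₁; proj₂)
open import Data.Sum.Base using (_⊎_; inj₁; inj₂)
open import Data.Unit.Base using (tt)
open import Data.Vec.Base using (tabulate)
open import Data.Vec.Properties using ([]=⇒lookup; lookup⇒[]=; lookup∘tabulate)
open import Function.Base using (_∘_; _$_)
open import Function.Bundles using (mk⇔)
open import Induction.WellFounded using (Acc; acc)
open import Level using (0ℓ)
open import Relation.Binary.Bundles using (DecTotalOrder)
open import Relation.Binary.Construct.Closure.ReflexiveTransitive as Star using (Star; ε; _◅_; _◅◅_)
import Relation.Binary.Construct.Flip.EqAndOrd as Flip
import Relation.Binary.Construct.On as On
open import Relation.Binary.Core using (Rel)
open import Relation.Binary.Definitions using (tri<; tri≈; tri>)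
open import Relation.Binary.PropositionalEquality
  using (_≡_; _≢_; _≗_; refl; sym; trans; cong; subst; subst₂; ≢-sym)
open import Relation.Nullary.Decidable
  using (Dec; yes; no; does; ¬?; _×-dec_; _⊎-dec_; _→-dec_; decidable-stable; dec-true)
open import Relation.Nullary.Negation using (¬_; contradiction)
open import Relation.Unary using (Pred; Decidable; U)

open Graph using () renaming (_~_ to Adj)

-- Least witnesses and counting in finite sets

least : ∀ {P : Pred ℕ 0ℓ} → Decidable P → ∀ m → P m → ∃ λ k → P k × (∀ {j} → P j → k ≤ j)
least {P} P? m p with P? 0
... | yes p₀ = 0 , p₀ , λ _ → z≤n
least {P} P? zero    p | no ¬p₀ = contradiction p ¬p₀
least {P} P? (suc m) p | no ¬p₀ with least (P? ∘ suc) m p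
... | k , pk , min = suc k , pk , λ {j} → bound j
  where
  bound : ∀ j → P j → suc k ≤ j
  bound zero    q = contradiction q ¬p₀
  bound (suc j) q = s≤s (min q)

∣m-n∣≤o : ∀ {m n o} → m ≤ o + n → n ≤ o + m → ∣ m - n ∣ ≤ o
∣m-n∣≤o {m} {n} p q with ℕ.∣m-n∣≡[m∸n]∨[n∸m] m n
... | inj₁ eq = subst (_≤ _) (sym eq) (ℕ.m≤n+o⇒m∸n≤o m n (subst (m ≤_) (ℕ.+-comm _ n) p))
... | inj₂ eq = subst (_≤ _) (sym eq) (ℕ.m≤n+o⇒m∸n≤o n m (subst (n ≤_) (ℕ.+-comm _ m) q))

injective⇒≤∣p∣ : ∀ {m n} (p : Subset n) (f : Fin m → Fin n) → (∀ i → f i ∈ p) →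
                 (∀ {i j} → f i ≡ f j → i ≡ j) → m ≤ ∣ p ∣
injective⇒≤∣p∣ {zero}  p f f∈p inj = z≤n
injective⇒≤∣p∣ {suc m} p f f∈p inj = ℕ.≤-<-trans
  (injective⇒≤∣p∣ (p ∖ f zero) (f ∘ suc)
    (λ i → x∈p∧x≢y⇒x∈p-y (f∈p (suc i)) (0≢1+n ∘ sym ∘ inj))
    (suc-injective ∘ inj))
  (x∈p⇒∣p-x∣<∣p∣ (f∈p zero))

-- Clique cover width

-- An ordered clique cover in functional form, `f x` being the place of the part that contains `x`.
-- Unlike in a cover, parts may be empty.
Labelling : ∀ {n N} → Graph n → ℕ → (Fin n → Fin N) → Set
Labelling G w f = (∀ x y → x ≢ y → f x ≡ f y → Adj G x y) ×
                  (∀ x y → Adj G x y → ∣ toℕ (f x) - toℕ (f y) ∣ ≤ w)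

labelling? : ∀ {n N} (G : Graph n) w (f : Fin n → Fin N) → Dec (Labelling G w f)
labelling? G w f =
  (all? λ x → all? λ y → ¬? (x ≟ y) →-dec (f x ≟ f y) →-dec (x ~? y)) ×-dec
  (all? λ x → all? λ y → (x ~? y) →-dec (_ ℕ.≤? w))
  where open Graph G

-- `finToFun` inverts `funToFin` only pointwise, so labellings have to be transported along
-- pointwise equality.
labelling-≗ : ∀ {n N} {G : Graph n} {w} {f g : Fin n → Fin N} → f ≗ g → Labelling G w f → Labelling G w g
labelling-≗ {w = w} f≗g (clique , short) =
  (λ x y x≢y eq → clique x y x≢y (trans (f≗g x) (trans eq (sym (f≗g y))))) ,
  (λ x y e → subst₂ (λ i j → ∣ toℕ i - toℕ j ∣ ≤ w) (f≗g x) (f≗g y) (short x y e))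

toℕ-punchOut-≤ : ∀ {n} {i j : Fin (suc n)} (i≢j : i ≢ j) → toℕ (punchOut i≢j) ≤ toℕ j
toℕ-punchOut-≤ {i = zero}  {zero}  i≢j = contradiction refl i≢j
toℕ-punchOut-≤ {i = zero}  {suc j} i≢j = ℕ.n≤1+n _
toℕ-punchOut-≤ {suc n} {suc i} {zero}  i≢j = z≤n
toℕ-punchOut-≤ {suc n} {suc i} {suc j} i≢j = s≤s (toℕ-punchOut-≤ (i≢j ∘ cong suc))

punchOut-nonexpansive : ∀ {n} {i j k : Fin (suc n)} (i≢j : i ≢ j) (i≢k : i ≢ k) →
                        ∣ toℕ (punchOut i≢j) - toℕ (punchOut i≢k) ∣ ≤ ∣ toℕ j - toℕ k ∣
punchOut-nonexpansive {i = zero} {zero}  {k}     i≢j i≢k = contradiction refl i≢j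
punchOut-nonexpansive {i = zero} {suc j} {zero}  i≢j i≢k = contradiction refl i≢k
punchOut-nonexpansive {i = zero} {suc j} {suc k} i≢j i≢k = ℕ.≤-refl
punchOut-nonexpansive {suc n} {suc i} {zero}  {zero}  i≢j i≢k = z≤n
punchOut-nonexpansive {suc n} {suc i} {zero}  {suc k} i≢j i≢k = s≤s (toℕ-punchOut-≤ (i≢k ∘ cong suc))
punchOut-nonexpansive {suc n} {suc i} {suc j} {zero}  i≢j i≢k = s≤s (toℕ-punchOut-≤ (i≢j ∘ cong suc))
punchOut-nonexpansive {suc n} {suc i} {suc j} {suc k} i≢j i≢k =
  punchOut-nonexpansive (i≢j ∘ cong suc) (i≢k ∘ cong suc)

Onto : ∀ {n N} → (Fin n → Fin N) → Set
Onto f = ∀ i → ∃ λ x → f x ≡ i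

compress : ∀ {n N} {G : Graph n} {w} (f : Fin n → Fin N) → Labelling G w f →
           ∃[ N′ ] ∃ λ (g : Fin n → Fin N′) → Onto g × Labelling G w g
compress {N = zero} f lab = 0 , f , (λ ()) , lab
compress {N = suc N} {G = G} f lab@(clique , short) with any? (λ i → all? λ x → ¬? (i ≟ f x))
... | yes (i , missed) = compress {G = G} (punchOut ∘ missed)
  ( (λ x y x≢y eq → clique x y x≢y (punchOut-injective (missed x) (missed y) eq))
  , (λ x y e → ℕ.≤-trans (punchOut-nonexpansive (missed x) (missed y)) (short x y e)))
... | no none = suc N , f , onto , lab
  where
  onto : Onto f
  onto i = decidable-stable (any? λ x → f x ≟ i)
             λ ¬hit → none (i , λ x eq → ¬hit (x , sym eq))

onto⇒≤ : ∀ {n N} {f : Fin n → Fin N} → Onto f → N ≤ n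
onto⇒≤ {f = f} onto = injective⇒≤ {f = λ i → proj₁ (onto i)}
  λ {i} {j} eq → trans (sym (proj₂ (onto i))) (trans (cong f eq) (proj₂ (onto j)))

module _ {n N} (f : Fin n → Fin N) where

  fibre : Fin N → Subset n
  fibre i = tabulate λ x → does (f x ≟ i)

  ∈-fibre⁺ : ∀ x → x ∈ fibre (f x)
  ∈-fibre⁺ x = lookup⇒[]= x _ (trans (lookup∘tabulate _ x) (dec-true (f x ≟ f x) refl))

  ∈-fibre⁻ : ∀ {i x} → x ∈ fibre i → f x ≡ i
  ∈-fibre⁻ {i} {x} x∈ with f x ≟ i | trans (sym (lookup∘tabulate (λ y → does (f y ≟ i)) x)) ([]=⇒lookup x∈)
  ... | yes eq | _ = eq
  ... | no _   | ()

module _ {n} {G : Graph n} (C : OrderedCliqueCover G) where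
  open OrderedCliqueCover C
  open IsPartition isPartition

  width-≤ : ∀ {w} → (∀ {i j x y} → Adj G x y → x ∈ part i → y ∈ part j → ∣ toℕ j - toℕ i ∣ ≤ w) → width C ≤ w
  width-≤ bound = max≤v⁺ z≤n $ All.map⁺ $ All.tabulate λ ij∈ →
    let _ , _ , e , x∈ , y∈ = proj₂ (∈-filter⁻ (joined? C) {xs = cartesianProduct (allFin size) (allFin size)} ij∈)
    in bound e x∈ y∈

  ≤-width : ∀ {i j x y} → Adj G x y → x ∈ part i → y ∈ part j → ∣ toℕ j - toℕ i ∣ ≤ width C
  ≤-width {i} {j} e x∈ y∈ = All.lookup (xs≤max 0 _) $ ∈-map⁺ _ $
    ∈-filter⁺ (joined? C) (∈-cartesianProduct⁺ (∈-allFin i) (∈-allFin j)) (_ , _ , e , x∈ , y∈)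

  place : Fin n → Fin size
  place x = proj₁ (covers x)

  place-onto : Onto place
  place-onto i = let x , x∈ = nonempty i in x , disjoint (proj₂ (covers x)) x∈

  -- Together with `onto⇒cover`, this lets the minimum over covers be taken over labellings.
  place-labelling : Labelling G (width C) place
  place-labelling =
    (λ x y x≢y eq → isClique _ (proj₂ (covers x)) (subst (λ i → y ∈ part i) (sym eq) (proj₂ (covers y))) x≢y) ,
    (λ x y e → ≤-width (Graph.sym G e) (proj₂ (covers y)) (proj₂ (covers x)))

onto⇒cover : ∀ {n N} {G : Graph n} {w} {f : Fin n → Fin N} → Onto f → Labelling G w f →
             ∃ λ (C : OrderedCliqueCover G) → width C ≤ w
onto⇒cover {n} {N} {G} {w} {f} onto (clique , short) = C , width-≤ C bound
  where
  C : OrderedCliqueCover G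
  C = record
    { part        = fibre f
    ; isPartition = record
      { nonempty = λ i → let x , eq = onto i in x , subst (λ j → x ∈ fibre f j) eq (∈-fibre⁺ f x)
      ; disjoint = λ x∈i x∈j → trans (sym (∈-fibre⁻ f x∈i)) (∈-fibre⁻ f x∈j)
      ; covers   = λ x → f x , ∈-fibre⁺ f x
      }
    ; isClique    = λ i x∈ y∈ x≢y → clique _ _ x≢y (trans (∈-fibre⁻ f x∈) (sym (∈-fibre⁻ f y∈)))
    }
  bound : ∀ {i j x y} → Adj G x y → x ∈ fibre f i → y ∈ fibre f j → ∣ toℕ j - toℕ i ∣ ≤ w
  bound {i} {j} {x} {y} e x∈ y∈ = subst₂ (λ i j → ∣ toℕ j - toℕ i ∣ ≤ w) (∈-fibre⁻ f x∈) (∈-fibre⁻ f y∈)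
    (short y x (Graph.sym G e))

-- An ordered clique cover has at most n parts, so labellings by Fin n suffice, and these are
-- enumerated by Fin (n ^ n); this makes the minimum in the definition of CCW computable.
labelling⇒CCW : ∀ {n N} {G : Graph n} {w} {f : Fin n → Fin N} → Labelling G w f →
                ∃[ w′ ] (IsCCW G w′ × w′ ≤ w)
labelling⇒CCW {n} {G = G} {w} {f} lab =
  -- The cover rebuilt from the optimal labelling has width at most `w′`; minimality over all covers
  -- turns this into equality.
  w′ , ((C , ℕ.≤-antisym C≤w′ (w′≤width C)) , w′≤width) , min (encode (compress {G = G} f lab))
  where
  Coded : ℕ → Set
  Coded v = ∃ λ (c : Fin (n ^ n)) → Labelling G v (finToFun {n} {n} c)
  encode : ∀ {v} → ∃[ N ] ∃ (λ (g : Fin n → Fin N) → Onto g × Labelling G v g) → Coded v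
  encode (N , g , onto , clique , short) =
    -- Surjectivity bounds the number of labels by `n`, and `inject≤` keeps their numerical values,
    -- hence all distances.
    funToFin h , labelling-≗ {G = G} (λ x → sym (finToFun-funToFin h x))
      ( (λ x y x≢y eq → clique x y x≢y (inject≤-injective N≤n N≤n _ _ eq))
      , (λ x y e → subst₂ (λ i j → ∣ i - j ∣ ≤ _)
          (sym (toℕ-inject≤ (g x) N≤n)) (sym (toℕ-inject≤ (g y) N≤n)) (short x y e)))
    where
    N≤n : N ≤ n
    N≤n = onto⇒≤ onto
    h : Fin n → Fin n
    h x = inject≤ (g x) N≤n
  optimum : ∃ λ v → Coded v × (∀ {j} → Coded j → v ≤ j)
  optimum = least (λ v → any? λ c → labelling? G v (finToFun {n} {n} c)) w (encode (compress {G = G} f lab))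
  w′ = proj₁ optimum
  min = proj₂ (proj₂ optimum)
  w′≤width : ∀ (C : OrderedCliqueCover G) → w′ ≤ width C
  w′≤width C = min (encode (_ , place C , place-onto C , place-labelling C))
  cover : ∃ λ (C : OrderedCliqueCover G) → width C ≤ w′
  cover with compress {G = G} (finToFun {n} {n} (proj₁ (proj₁ (proj₂ optimum)))) (proj₂ (proj₁ (proj₂ optimum)))
  ... | _ , _ , onto , lab′ = onto⇒cover {G = G} onto lab′
  C = proj₁ cover
  C≤w′ = proj₂ cover

-- Tree decompositions

module _ {n} (G : Graph n) where
  open Graph G using (_~_; _~?_; irrefl)

  -- The condition is recorded at both ends of a step so that such walks can be reversed.
  Within : Pred (Fin n) 0ℓ → Rel (Fin n) 0ℓ
  Within P u v = u ~ v × P u × P v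

  suffix : ∀ {P : Pred (Fin n) 0ℓ} {x y v} (p : Walk G x y) → IsPath G p → All P (vertices G p) →
           v List.∈ vertices G p → ∃ λ (q : Walk G v y) → IsPath G q × All P (vertices G q)
  suffix ε       uniq       all       (here refl) = ε , uniq , all
  suffix (e ◅ p) uniq       all       (here refl) = e ◅ p , uniq , all
  suffix (e ◅ p) (_ ∷ uniq) (_ ∷ all) (there v∈)  = suffix p uniq all v∈

  -- Induction on the walk: if its first vertex recurs on the path found for the rest, `suffix` cuts
  -- the path there; otherwise the vertex is prepended.
  erase-loops : ∀ {P : Pred (Fin n) 0ℓ} {x y} → Star (Within P) x y → P x →
                ∃ λ (p : Walk G x y) → IsPath G p × All P (vertices G p)
  erase-loops ε px = ε , [] ∷ [] , px ∷ []
  erase-loops {x = x} ((e , _ , px′) ◅ w) px with erase-loops w px′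
  ... | p , uniq , all with member? _≟_ x (vertices G p)
  ...   | yes x∈ = suffix p uniq all x∈
  ...   | no x∉  = e ◅ p , All.¬Any⇒All¬ _ x∉ ∷ uniq , px ∷ all

  vertices-◅◅-◅ : ∀ {x y z t} (p : Walk G x y) (e : y ~ z) (q : Walk G z t) →
                  vertices G (p ◅◅ e ◅ q) ≡ vertices G p ++ vertices G q
  vertices-◅◅-◅ ε       e q = refl
  vertices-◅◅-◅ (d ◅ p) e q = cong (_ ∷_) (vertices-◅◅-◅ p e q)

  last-∈ : ∀ {x y} (p : Walk G x y) → y List.∈ vertices G p
  last-∈ ε       = here refl
  last-∈ (_ ◅ p) = there (last-∈ p)

  -- Fixing the length makes existence decidable, so that `least` can find the distance to the root.
  WalkOfLength : ℕ → Fin n → Fin n → Set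
  WalkOfLength zero    x y = x ≡ y
  WalkOfLength (suc m) x y = ∃ λ z → x ~ z × WalkOfLength m z y

  walkOfLength? : ∀ m x y → Dec (WalkOfLength m x y)
  walkOfLength? zero    x y = x ≟ y
  walkOfLength? (suc m) x y = any? λ z → (x ~? z) ×-dec walkOfLength? m z y

  walk-length : ∀ {x y} → Walk G x y → ∃ λ m → WalkOfLength m x y
  walk-length ε       = 0 , refl
  walk-length (e ◅ p) = let m , w = walk-length p in suc m , _ , e , w

  module Rooted (connected : Connected G) where

    root : Fin n
    root = proj₁ connected

    shortest : ∀ x → ∃ λ m → WalkOfLength m x root × (∀ {k} → WalkOfLength k x root → m ≤ k)
    shortest x = let m , w = walk-length (proj₂ connected x root) in
      least (λ m → walkOfLength? m x root) m w

    distance : Fin n → ℕ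
    distance x = proj₁ (shortest x)

    -- Distance to the root with ties broken by vertex number: since `toℕ x` is below `n`, depth is
    -- injective and still respects distance.
    depth : Fin n → ℕ
    depth x = n * distance x + toℕ x

    distance<⇒depth< : ∀ {x y} → distance x < distance y → depth x < depth y
    distance<⇒depth< {x} {y} lt = begin-strict
      n * distance x + toℕ x  <⟨ ℕ.+-monoʳ-< (n * distance x) (toℕ<n x) ⟩
      n * distance x + n      ≡⟨ ℕ.+-comm _ n ⟩
      n + n * distance x      ≡⟨ ℕ.*-suc n _ ⟨
      n * suc (distance x)    ≤⟨ ℕ.*-monoʳ-≤ n lt ⟩
      n * distance y          ≤⟨ ℕ.m≤m+n _ _ ⟩
      depth y                 ∎
      where open ℕ.≤-Reasoning

    depth-injective : ∀ {x y} → depth x ≡ depth y → x ≡ y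
    depth-injective {x} {y} eq with ℕ.<-cmp (distance x) (distance y)
    ... | tri< lt _ _ = contradiction eq (ℕ.<⇒≢ (distance<⇒depth< lt))
    ... | tri> _ _ gt = contradiction (sym eq) (ℕ.<⇒≢ (distance<⇒depth< gt))
    ... | tri≈ _ d≡ _ = toℕ-injective (ℕ.+-cancelˡ-≡ (n * distance x) _ _
                          (trans eq (cong (λ d → n * d + toℕ y) (sym d≡))))

    -- The second vertex of a shortest walk to the root is strictly closer to the root.
    parent : ∀ x → x ≡ root ⊎ (∃ λ y → x ~ y × depth y < depth x)
    parent x = go (distance x) refl (proj₁ (proj₂ (shortest x)))
      where
      go : ∀ d → distance x ≡ d → WalkOfLength d x root → x ≡ root ⊎ (∃ λ y → x ~ y × depth y < depth x)
      go zero    _  w           = inj₁ w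
      go (suc d) eq (y , e , w) = inj₂ (y , e , distance<⇒depth<
        (subst (distance y <_) (sym eq) (s≤s (proj₂ (proj₂ (shortest y)) w))))

    -- Depth falls along parents, so the walk through them stays below `m` and, by well-founded
    -- induction, reaches the root.
    descend : ∀ {m} x → depth x < m → depth root < m × Star (Within λ v → depth v < m) x root
    descend {m} x = go x (<-wellFounded (depth x))
      where
      go : ∀ x → Acc _<_ (depth x) → depth x < m →
           depth root < m × Star (Within λ v → depth v < m) x root
      go x (acc rs) x<m with parent x
      ... | inj₁ refl = x<m , ε
      ... | inj₂ (y , e , y<x) with ℕ.<-trans y<x x<m
      ...   | y<m with go y (rs y<x) y<m
      ...     | root<m , w = root<m , (e , x<m , y<m) ◅ w

    -- The walk descends from the parent of a to the root and climbs to b.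
    leave : ∀ {a b} → depth b < depth a →
            ∃ λ c → a ~ c × ∃ λ (p : Walk G c b) → IsPath G p × All (λ v → depth v < depth a) (vertices G p)
    leave {a} {b} b<a with parent a | descend b b<a
    -- Were `a` the root, the descent from `b` would put the root below itself.
    ... | inj₁ refl          | root<root , _ = contradiction root<root (ℕ.<-irrefl refl)
    ... | inj₂ (c , e , c<a) | _ , up = c , e ,
      erase-loops (proj₂ (descend c c<a) ◅◅ Star.reverse (λ (e , p , q) → Graph.sym G e , q , p) up) c<a

module _ {n} {G : Graph n} (D : TreeDecomposition G) where
  open TreeDecomposition D
  open Rooted tree (proj₁ isTree)

  -- `least` searches numbers, so the depth is minimised and the node comes along as a witness.
  top : ∀ x → ∃ λ d → (∃ λ j → depth j ≡ d × x ∈ bag j) ×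
                      (∀ {e} → (∃ λ j → depth j ≡ e × x ∈ bag j) → d ≤ e)
  top x = let j , x∈ = vertex-∈ x in
    least (λ d → any? λ j → (depth j ℕ.≟ d) ×-dec (x ∈? bag j)) (depth j) (j , refl , x∈)

  home : Fin n → Fin nodes
  home x = proj₁ (proj₁ (proj₂ (top x)))

  ∈-home : ∀ x → x ∈ bag (home x)
  ∈-home x = proj₂ (proj₂ (proj₁ (proj₂ (top x))))

  level : Fin n → ℕ
  level x = depth (home x)

  level-≤ : ∀ {x j} → x ∈ bag j → level x ≤ depth j
  level-≤ {x} x∈ = subst (_≤ _) (sym (proj₁ (proj₂ (proj₁ (proj₂ (top x)))))) (proj₂ (proj₂ (top x)) (_ , refl , x∈))

  -- A path from j to home x stays in bags containing x, hence is disjoint from the path by which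
  -- home x is left towards home y; so home x lies on a path from j to home y.
  shared⇒∈-home : ∀ {x y j} → x ∈ bag j → y ∈ bag j → level y ≤ level x → y ∈ bag (home x)
  shared⇒∈-home {x} {y} {j} x∈ y∈ y≤x with home x ≟ home y
  ... | yes eq = subst (λ h → y ∈ bag h) (sym eq) (∈-home y)
  ... | no neq with leave (ℕ.≤∧≢⇒< y≤x (λ eq → neq (sym (depth-injective eq))))
                  | erase-loops tree {P = U} (Star.map (_, tt , tt) (proj₂ (proj₁ isTree) j (home x))) tt
  ...   | c , e , q , q-path , below | p , p-path , _ =
    path-∩-⊆ (p ◅◅ e ◅ q)
      (subst Unique (sym split) (unique-++⁺ p-path q-path disjoint))
      (subst (home x List.∈_) (sym split) (∈-++⁺ˡ (last-∈ tree p)))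
      (x∈p∩q⁺ (y∈ , ∈-home y))
    where
    split = vertices-◅◅-◅ tree p e q
    disjoint : ∀ {v} → ¬ (v List.∈ vertices tree p × v List.∈ vertices tree q)
    -- The bag at a common node would contain `x` at a depth below that of `home x`.
    disjoint (v∈p , v∈q) = ℕ.<⇒≱ (All.lookup below v∈q)
      (level-≤ (path-∩-⊆ p p-path v∈p (x∈p∩q⁺ (x∈ , ∈-home x))))

  -- The fill-in of `G` that turns every bag into a clique; it serves as the chordal graph.
  sharing : Graph n
  sharing = record
    { _~_    = λ x y → x ≢ y × ∃ λ j → x ∈ bag j × y ∈ bag j
    ; sym    = λ (x≢y , j , x∈ , y∈) → ≢-sym x≢y , j , y∈ , x∈
    ; irrefl = λ x≡y (x≢y , _) → x≢y x≡y
    ; _~?_   = λ x y → ¬? (x ≟ y) ×-dec any? λ j → (x ∈? bag j) ×-dec (y ∈? bag j)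
    }

-- Elimination orders

↝-functional : ∀ {ℓ} {i j k : Fin ℓ} → i ↝ j → i ↝ k → j ≡ k
↝-functional (inj₁ p) (inj₁ q) = toℕ-injective (trans p (sym q))
↝-functional {j = j} (inj₁ p) (inj₂ (q , _)) = contradiction (trans p q) (ℕ.<⇒≢ (toℕ<n j))
↝-functional {k = k} (inj₂ (p , _)) (inj₁ q) = contradiction (trans q p) (ℕ.<⇒≢ (toℕ<n k))
↝-functional (inj₂ (_ , p)) (inj₂ (_ , q)) = toℕ-injective (trans p (sym q))

module _ {ℓ : ℕ} where

  -- The relation _↝_ on naturals, where case analysis can substitute the equations.
  Next : ℕ → ℕ → Set
  Next a b = (b ≡ suc a) ⊎ (suc a ≡ ℓ × b ≡ 0)

  -- Each `Next` step adds 1 modulo `ℓ`, so m steps return to the start only if `ℓ` divides m. Here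
  -- and in the next two lemmas, m is 1, 2 and 3, always less than `ℓ`.
  ¬1-cycle : ∀ {a} → 2 ≤ ℓ → ¬ Next a a
  ¬1-cycle 2≤ℓ (inj₁ eq) = ℕ.1+n≢n (sym eq)
  ¬1-cycle 2≤ℓ (inj₂ (refl , refl)) = ℕ.1+n≰n 2≤ℓ

  ¬2-cycle : ∀ {a b} → 3 ≤ ℓ → Next a b → ¬ Next b a
  ¬2-cycle {a} 3≤ℓ (inj₁ refl) (inj₁ eq) = ℕ.m≢1+m+n a (trans eq (cong suc (ℕ.+-comm 1 a)))
  ¬2-cycle 3≤ℓ (inj₁ refl) (inj₂ (refl , refl)) = ℕ.1+n≰n 3≤ℓ
  ¬2-cycle 3≤ℓ (inj₂ (refl , refl)) (inj₁ refl) = ℕ.1+n≰n 3≤ℓ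
  ¬2-cycle (s≤s ()) (inj₂ (refl , refl)) (inj₂ (_ , refl))

  ¬3-cycle : ∀ {a b c} → 4 ≤ ℓ → Next a b → Next b c → ¬ Next c a
  ¬3-cycle {a} 4≤ℓ (inj₁ refl) (inj₁ refl) (inj₁ eq) = ℕ.m≢1+m+n a (trans eq (cong suc (ℕ.+-comm 2 a)))
  ¬3-cycle 4≤ℓ (inj₁ refl) (inj₁ refl) (inj₂ (refl , refl)) = ℕ.1+n≰n 4≤ℓ
  ¬3-cycle 4≤ℓ (inj₁ refl) (inj₂ (refl , refl)) (inj₁ refl) = ℕ.1+n≰n 4≤ℓ
  ¬3-cycle 4≤ℓ (inj₁ refl) (inj₂ (refl , refl)) (inj₂ (() , _))
  ¬3-cycle 4≤ℓ (inj₂ (refl , refl)) (inj₁ refl) (inj₁ refl) = ℕ.1+n≰n 4≤ℓ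
  ¬3-cycle 4≤ℓ (inj₂ (refl , refl)) (inj₁ refl) (inj₂ (refl , ()))
  ¬3-cycle (s≤s ()) (inj₂ (_ , refl)) (inj₂ (refl , refl)) _

successor : ∀ {ℓ} (i : Fin ℓ) → ∃ λ j → i ↝ j
successor {suc ℓ} i with suc (toℕ i) ℕ.<? suc ℓ
... | yes lt = fromℕ< lt , inj₁ (toℕ-fromℕ< lt)
... | no ≮   = zero , inj₂ (ℕ.≤-antisym (toℕ<n i) (ℕ.≮⇒≥ ≮) , refl)

predecessor : ∀ {ℓ} (i : Fin ℓ) → ∃ λ j → j ↝ i
predecessor {suc ℓ} zero = fromℕ ℓ , inj₂ (cong suc (toℕ-fromℕ ℓ) , refl)
predecessor (suc i) = inject₁ i , inj₁ (cong suc (sym (toℕ-inject₁ i)))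

module _ {n} (G : Graph n) (ρ : Fin n → ℕ) where
  open Graph G using (_~_; _~?_; irrefl)

  -- On a cycle, the two neighbours of a vertex of greatest `ρ` are adjacent by hypothesis; as the
  -- length is at least four, that edge is a chord.
  simplicial⇒chordal : (∀ {u v w} → v ~ u → v ~ w → u ≢ w → ρ u ≤ ρ v → ρ w ≤ ρ v → u ~ w) → Chordal G
  simplicial⇒chordal simplicial {ℓ@(suc _)} 4≤ℓ c chordless =
    impossible $ chordless before after $
      simplicial (Graph.sym G (adjacent before↝i)) (adjacent i↝after)
                 (distinct ∘ injective) (highest before) (highest after)
    where
    open Cycle c
    i : Fin ℓ
    i = argmax (ρ ∘ vertex) zero (allFin ℓ)
    before after : Fin ℓ
    before = proj₁ (predecessor i)
    after  = proj₁ (successor i)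
    before↝i : before ↝ i
    before↝i = proj₂ (predecessor i)
    i↝after : i ↝ after
    i↝after = proj₂ (successor i)
    highest : ∀ j → ρ (vertex j) ≤ ρ (vertex i)
    highest j = All.lookup (f[xs]≤f[argmax] {f = ρ ∘ vertex} zero (allFin ℓ)) (∈-allFin j)
    distinct : before ≢ after
    distinct eq = ¬2-cycle 3≤ℓ before↝i (subst (i ↝_) (sym eq) i↝after)
    impossible : ¬ (before ↝ after ⊎ after ↝ before)
    impossible (inj₁ before↝after) =
      ¬1-cycle (ℕ.<⇒≤ 3≤ℓ) (subst (i ↝_) (sym (↝-functional before↝i before↝after)) i↝after)
    impossible (inj₂ after↝before) = ¬3-cycle 4≤ℓ before↝i i↝after after↝before

  -- Greedy colouring by increasing `ρ`: when `x` is reached, its coloured neighbours lie in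
  -- `near x` apart from `x` itself, so fewer than `t` colours are taken.
  colour-along : ∀ {t} (near : Fin n → Subset n) →
    (∀ x → x ∈ near x) → (∀ x → ∣ near x ∣ ≤ t) →
    (∀ {x y} → x ~ y → ρ y ≤ ρ x → y ∈ near x) →
    ∃ λ (colour : Fin n → Fin t) → ∀ {x y} → x ~ y → colour x ≢ colour y
  colour-along {t} near x∈near near≤t ~⇒∈near =
    let colour , proper = go (sort (allFin n))
                             (Sorted⇒AllPairs (DecTotalOrder.totalOrder order) (sort-↗ (allFin n)))
    in colour , λ {x} {y} → proper (listed x) (listed y)
    where
    -- The order is reversed because `go` colours the tail of the list before its head, so the head
    -- must have the largest `ρ`.
    order = Flip.decTotalOrder (On.decTotalOrder ℕ.≤-decTotalOrder ρ)
    open Sort order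
    listed : ∀ x → x List.∈ sort (allFin n)
    listed x = ∈-resp-↭ (↭-sym (sort-↭ (allFin n))) (∈-allFin x)

    Proper : List (Fin n) → (Fin n → Fin t) → Set
    Proper xs colour = ∀ {x y} → x List.∈ xs → y List.∈ xs → x ~ y → colour x ≢ colour y

    Taken : List (Fin n) → Fin n → (Fin n → Fin t) → Fin t → Set
    Taken xs x colour c = ∃ λ y → y List.∈ xs × x ~ y × colour y ≡ c

    taken? : ∀ xs x colour c → Dec (Taken xs x colour c)
    taken? xs x colour c = any? λ y → member? _≟_ y xs ×-dec (x ~? y) ×-dec (colour y ≟ c)

    -- Choosing a neighbour for each colour would embed `t` elements into `near x` without `x`, a
    -- set of fewer than `t` elements.
    ¬all-taken : ∀ {xs x} colour → All (λ y → ρ y ≤ ρ x) xs → ¬ (∀ c → Taken xs x colour c)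
    ¬all-taken {xs} {x} colour below taken = ℕ.<-irrefl refl $ begin-strict
      t                ≤⟨ injective⇒≤∣p∣ (near x ∖ x) (proj₁ ∘ taken) in-near
                            (λ {c} {d} eq → trans (sym (colour≡ c)) (trans (cong colour eq) (colour≡ d))) ⟩
      ∣ near x ∖ x ∣   <⟨ x∈p⇒∣p-x∣<∣p∣ (x∈near x) ⟩
      ∣ near x ∣       ≤⟨ near≤t x ⟩
      t                ∎
      where
      open ℕ.≤-Reasoning
      colour≡ : ∀ c → colour (proj₁ (taken c)) ≡ c
      colour≡ c = proj₂ (proj₂ (proj₂ (taken c)))
      in-near : ∀ c → proj₁ (taken c) ∈ near x ∖ x
      in-near c with taken c
      ... | y , y∈ , e , _ = x∈p∧x≢y⇒x∈p-y (~⇒∈near e (All.lookup below y∈)) (λ y≡x → irrefl (sym y≡x) e)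

    extend : ∀ {xs x colour c} → Proper xs colour → ¬ Taken xs x colour c → ∃ (Proper (x ∷ xs))
    extend {xs} {x} {colour} {c} proper free = colour′ , proper′
      where
      colour′ : Fin n → Fin t
      colour′ y = if does (y ≟ x) then c else colour y
      tail : ∀ {y} → y List.∈ x ∷ xs → y ≢ x → y List.∈ xs
      tail (here y≡x) y≢x = contradiction y≡x y≢x
      tail (there y∈) _   = y∈
      proper′ : Proper (x ∷ xs) colour′
      proper′ {u} {v} u∈ v∈ e eq with u ≟ x | v ≟ x
      ... | yes refl | yes refl = irrefl refl e
      ... | yes refl | no v≢x   = free (v , tail v∈ v≢x , e , sym eq)
      ... | no u≢x   | yes refl = free (u , tail u∈ u≢x , Graph.sym G e , eq)
      ... | no u≢x   | no v≢x   = proper (tail u∈ u≢x) (tail v∈ v≢x) e eq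

    go : ∀ xs → AllPairs (λ x y → ρ y ≤ ρ x) xs → ∃ (Proper xs)
    -- The starting colouring is constantly zero; `t` is positive because `near x` contains `x`.
    go []       _ = (λ x → fromℕ< (ℕ.<-≤-trans (ℕ.≤-<-trans z≤n (x∈p⇒∣p-x∣<∣p∣ (x∈near x))) (near≤t x))) , λ ()
    go (x ∷ xs) (below ∷ sorted) with go xs sorted
    ... | colour , proper with any? (λ c → ¬? (taken? xs x colour c))
    ...   | yes (c , free) = extend proper free
    ...   | no ¬free = contradiction
      (λ c → decidable-stable (taken? xs x colour c) (λ ¬taken → ¬free (c , ¬taken)))
      (¬all-taken colour below)

-- Lexicographic positions

-- The extreme case is the last colour of one layer against the first colour of the layer before: t
-- + (t - 1) places apart.
combine-≤ : ∀ {k t} {i j : Fin k} (c d : Fin t) → toℕ i ≤ suc (toℕ j) →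
            toℕ (combine i c) ≤ 2 * t ∸ 1 + toℕ (combine j d)
combine-≤ {t = t@(suc s)} {i} {j} c d i≤1+j = begin
  toℕ (combine i c)                    ≡⟨ toℕ-combine i c ⟩
  t * toℕ i + toℕ c                    ≤⟨ ℕ.+-mono-≤ (ℕ.*-monoʳ-≤ t i≤1+j) (toℕ≤pred[n] c) ⟩
  t * suc (toℕ j) + s                  ≡⟨ arith s (toℕ j) ⟩
  2 * t ∸ 1 + t * toℕ j                ≤⟨ ℕ.+-monoʳ-≤ (2 * t ∸ 1) (ℕ.m≤m+n _ _) ⟩
  2 * t ∸ 1 + (t * toℕ j + toℕ d)      ≡⟨ cong (2 * t ∸ 1 +_) (toℕ-combine j d) ⟨
  2 * t ∸ 1 + toℕ (combine j d)        ∎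
  where
  open ℕ.≤-Reasoning
  -- With `t` equal to `suc s`, the truncated `2 * t ∸ 1` reduces to `s + (suc s + 0)`.
  arith : ∀ s j → suc s * suc j + s ≡ s + (suc s + 0) + suc s * j
  arith = solve-∀

-- The two graphs of the intersection

theorem2 : ∀ {n k : ℕ} (G : Graph n) → Connected G →
    (L : Fin k → Subset n) → IsLayering G L →
    (D : TreeDecomposition G) →
    ∃[ G₁ ] ∃[ G₂ ]
    ((∃[ w ] (IsCCW G₁ w × w ≤ 2 * maxLayerBag L D ∸ 1))
    × Chordal G₂
    × G ≈ᴳ G₁ ∩ᴳ G₂)
theorem2 {n} {k} G _ L isLayering D = G₁ , sharing D , labelling⇒CCW {G = G₁} labelling , chordal , equal
  where
  open IsLayering isLayering
  open IsPartition isPartition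
  open TreeDecomposition D
  open Graph G using (_~_; _~?_)

  t : ℕ
  t = maxLayerBag L D

  layer : Fin n → Fin k
  layer x = proj₁ (covers x)

  layer-≡ : ∀ {x i} → x ∈ L i → layer x ≡ i
  layer-≡ {x} = disjoint (proj₂ (covers x))

  -- One of the intersections over which `t` is the maximum. It catches `x` and every `conflict`
  -- neighbour of `x` whose level is no greater.
  near : Fin n → Subset n
  near x = L (layer x) ∩ bag (home D x)

  near≤t : ∀ x → ∣ near x ∣ ≤ t
  near≤t x = All.lookup (xs≤max 0 _) $ ∈-map⁺ _ (∈-cartesianProduct⁺ (∈-allFin (layer x)) (∈-allFin (home D x)))

  -- Colours need to differ only inside a layer, since `position` separates the layers; hence the
  -- same `t` colours serve all of them.
  conflict : Graph n
  conflict = record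
    { _~_    = λ x y → layer x ≡ layer y × Adj (sharing D) x y
    ; sym    = λ (eq , e) → sym eq , Graph.sym (sharing D) e
    ; irrefl = λ x≡y (_ , e) → Graph.irrefl (sharing D) x≡y e
    ; _~?_   = λ x y → (layer x ≟ layer y) ×-dec Graph._~?_ (sharing D) x y
    }

  colouring : ∃ λ (colour : Fin n → Fin t) → ∀ {x y} → Adj conflict x y → colour x ≢ colour y
  colouring = colour-along conflict (level D) near (λ x → x∈p∩q⁺ (proj₂ (covers x) , ∈-home D x)) near≤t
    λ {x} {y} (eq , _ , j , x∈ , y∈) y≤x →
      x∈p∩q⁺ (subst (λ i → y ∈ L i) (sym eq) (proj₂ (covers y)) , shared⇒∈-home D x∈ y∈ y≤x)

  colour : Fin n → Fin t
  colour = proj₁ colouring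

  position : Fin n → Fin (k * t)
  position x = combine (layer x) (colour x)

  G₁ : Graph n
  G₁ = record
    { _~_    = λ x y → x ~ y ⊎ (x ≢ y × position x ≡ position y)
    ; sym    = λ where
        (inj₁ e)          → inj₁ (Graph.sym G e)
        (inj₂ (x≢y , eq)) → inj₂ (≢-sym x≢y , sym eq)
    ; irrefl = λ where
        x≡y (inj₁ e)         → Graph.irrefl G x≡y e
        x≡y (inj₂ (x≢y , _)) → x≢y x≡y
    ; _~?_   = λ x y → (x ~? y) ⊎-dec ¬? (x ≟ y) ×-dec (position x ≟ position y)
    }

  layers-close : ∀ {x y} → x ~ y → toℕ (layer x) ≤ suc (toℕ (layer y))
  layers-close {x} {y} e with edges e
  ... | inj₁ (i , x∈ , y∈) rewrite layer-≡ x∈ | layer-≡ y∈ = ℕ.n≤1+n _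
  ... | inj₂ (inj₁ (i , j , eq , x∈ , y∈)) rewrite layer-≡ x∈ | layer-≡ y∈ | eq = ℕ.m≤n⇒m≤1+n (ℕ.n≤1+n _)
  ... | inj₂ (inj₂ (i , j , eq , y∈ , x∈)) rewrite layer-≡ x∈ | layer-≡ y∈ | eq = ℕ.≤-refl

  labelling : Labelling G₁ (2 * t ∸ 1) position
  labelling = (λ x y x≢y eq → inj₂ (x≢y , eq)) , λ where
    x y (inj₁ e) → ∣m-n∣≤o
      (combine-≤ {i = layer x} {layer y} (colour x) (colour y) (layers-close e))
      (combine-≤ {i = layer y} {layer x} (colour y) (colour x) (layers-close (Graph.sym G e)))
    -- An added edge joins equal positions, so it spans distance zero.
    x y (inj₂ (_ , eq)) → subst (_≤ _) (sym (ℕ.m≡n⇒∣m-n∣≡0 (cong toℕ eq))) z≤n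

  chordal : Chordal (sharing D)
  chordal = simplicial⇒chordal (sharing D) (level D)
    λ {u} {v} {w} (_ , _ , v∈ , u∈) (_ , _ , v∈′ , w∈) u≢w u≤v w≤v →
      u≢w , home D v , shared⇒∈-home D v∈ u∈ u≤v , shared⇒∈-home D v∈′ w∈ w≤v

  equal : G ≈ᴳ G₁ ∩ᴳ sharing D
  equal x y = mk⇔ (λ e → inj₁ e , (λ x≡y → Graph.irrefl G x≡y e) , edge-∈ e) λ where
    (inj₁ e , _)        → e
    -- Equal positions mean equal layer and equal colour, which the colouring forbids for vertices
    -- sharing a bag.
    (inj₂ (_ , eq) , s) → let layers , colours = combine-injective (layer x) (colour x) (layer y) (colour y) eq in
      contradiction colours (proj₂ colouring (layers , s))
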